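{- Let $q>3$ be a prime and let $r$ be a positive divisor of $q-1$. Then $G(3q,r)=G(3q;r,2,u)$, where $u=r$ if $r$ is even, and $u=2r$ if $r$ is odd.
   Context: $H(q,r)$ is the unique subgroup of order $r$ of $\mathbb{Z}_q^*$. The graph $G(3q,r)$ has vertex set $\mathbb{Z}_3\times\mathbb{Z}_q$ and edge set $\{\{(i,x),(i+1,y)\}: i\in\mathbb{Z}_3,\ x,y\in\mathbb{Z}_q,\ y-x\in H(q,r)\}$. For primes $p<q$, an even divisor $s$ of $p-1$ and a divisor $r$ of $q-1$, let $H(p,s)=\langle a\rangle\le\mathbb{Z}_p^*$ be the subgroup of order $s$, let $t\in\mathbb{Z}_q^*$ be such that $t^{s/2}\in -H(q,r)$, and let $u=\mathrm{lcm}(r,o(t))$ where $o(t)$ is the order of $t$ in $\mathbb{Z}_q^*$. The graph $G(pq;r,s,u)$ has vertex set $\mathbb{Z}_p\times\mathbb{Z}_q$, with $(i,x)$ and $(j,y)$ adjacent iff there is an integer $l$ such that $j-i=a^l$ and $y-x\in t^lH(q,r)$. Here $p=3$ and $s=2$, so $a=-1$ and $t\in -H(q,r)$. -}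

module Defs where

open import Data.Fin using (Fin; toℕ)
open import Data.Fin.Subset using (Subset; _∈_; ∣_∣)
open import Data.Integer using (ℤ; +_; -[1+_])
open import Data.Nat using (ℕ; zero; suc; _+_; _*_; _∸_; _≤_; _<_; NonZero)
open import Data.Nat.Divisibility using (_∣_)
open import Data.Nat.DivMod using (_/_; _mod_)
open import Data.Nat.LCM using (lcm)
open import Data.Nat.Primality using (Prime)
open import Data.Product using (∃-syntax; _×_; _,_)
open import Data.Sum using (_⊎_)
open import Function.Bundles using (_⇔_)
open import Level using (0ℓ)
open import Relation.Binary.Core using (Rel)
open import Relation.Binary.PropositionalEquality using (_≡_)

-- The ring ℤ_n, carried by the residues Fin n.

module _ {n : ℕ} .{{_ : NonZero n}} where

  infixl 6 _+ₙ_ _-ₙ_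
  infixl 7 _*ₙ_
  infix  8 -ₙ_
  infixr 9 _^ₙ_

  1ₙ : Fin n
  1ₙ = 1 mod n

  _+ₙ_ _-ₙ_ _*ₙ_ : Fin n → Fin n → Fin n
  x +ₙ y = (toℕ x + toℕ y) mod n
  x -ₙ y = (toℕ x + (n ∸ toℕ y)) mod n
  x *ₙ y = (toℕ x * toℕ y) mod n

  -ₙ_ : Fin n → Fin n
  -ₙ x = (n ∸ toℕ x) mod n

  _^ₙ_ : Fin n → ℕ → Fin n
  x ^ₙ zero  = 1ₙ
  x ^ₙ suc k = x *ₙ x ^ₙ k

record Unit (n : ℕ) .{{_ : NonZero n}} : Set where
  field
    val     : Fin n
    inv     : Fin n
    inverse : val *ₙ inv ≡ 1ₙ

module _ {n : ℕ} .{{_ : NonZero n}} where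

  open Unit

  infixr 9 _^ℤ_

  _^ℤ_ : Unit n → ℤ → Fin n
  a ^ℤ (+ k)    = val a ^ₙ k
  a ^ℤ -[1+ k ] = inv a ^ₙ suc k

  IsOrderOf : ℕ → Unit n → Set
  IsOrderOf m a =
    0 < m × val a ^ₙ m ≡ 1ₙ × (∀ k → 0 < k → val a ^ₙ k ≡ 1ₙ → m ≤ k)

  -- H, a set of residues, is a subgroup of ℤ_n^* with r elements;
  -- has-inverses also forces the members of H to be units.
  record IsUnitSubgroup (H : Subset n) (r : ℕ) : Set where
    field
      has-one      : 1ₙ ∈ H
      closed       : ∀ {x y} → x ∈ H → y ∈ H → x *ₙ y ∈ H
      has-inverses : ∀ {x} → x ∈ H → ∃[ y ] (y ∈ H × x *ₙ y ≡ 1ₙ)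
      order        : ∣ H ∣ ≡ r

  _IsGeneratedBy_ : Subset n → Unit n → Set
  H IsGeneratedBy a = ∀ x → (x ∈ H) ⇔ (∃[ l ] x ≡ a ^ℤ l)

  infix 4 _∈-_ _∈_·_

  _∈-_ : Fin n → Subset n → Set
  x ∈- H = ∃[ h ] (h ∈ H × x ≡ -ₙ h)

  _∈_·_ : Fin n → Fin n → Subset n → Set
  x ∈ c · H = ∃[ h ] (h ∈ H × x ≡ c *ₙ h)

-- A graph on ℤ_p × ℤ_q is its adjacency relation.  Throughout, H stands for
-- H(q,r): for q prime, the only H with IsUnitSubgroup H r.

Graph : ℕ → ℕ → Set₁
Graph p q = Rel (Fin p × Fin q) 0ℓ

-- G(3q,r)
G₃ : (q : ℕ) .{{_ : NonZero q}} (H : Subset q) → Graph 3 q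
G₃ q H v w =
  ∃[ i ] ∃[ x ] ∃[ y ]
    ( (y -ₙ x) ∈ H
    × ( (v ≡ (i , x) × w ≡ (i +ₙ 1ₙ , y))
      ⊎ (v ≡ (i +ₙ 1ₙ , y) × w ≡ (i , x)) ) )

-- The data behind the notation G(pq;r,s,u), which leaves a and t implicit.
-- K is H(p,s) and o is the order of t.
record Parameters (p q r s u : ℕ) .{{_ : NonZero p}} .{{_ : NonZero q}}
                  (H : Subset q) : Set where
  field
    p-prime    : Prime p
    q-prime    : Prime q
    p<q        : p < q
    s-even     : 2 ∣ s
    s∣p-1      : s ∣ p ∸ 1
    r∣q-1      : r ∣ q ∸ 1
    H-subgroup : IsUnitSubgroup H r
    K          : Subset p
    K-subgroup : IsUnitSubgroup K s
    a          : Unit p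
    K-gen      : K IsGeneratedBy a
    t          : Unit q
    t-power    : Unit.val t ^ₙ (s / 2) ∈- H
    o          : ℕ
    t-order    : IsOrderOf o t
    u-def      : u ≡ lcm r o

-- G(pq;r,s,u)
G : ∀ {p q r s u} .{{_ : NonZero p}} .{{_ : NonZero q}} {H : Subset q} →
    Parameters p q r s u H → Graph p q
G {H = H} P (i , x) (j , y) =
  ∃[ l ] (j -ₙ i ≡ a ^ℤ l × (y -ₙ x) ∈ (t ^ℤ l) · H)
  where open Parameters P

{-# OPTIONS --safe #-}
-- Because t ∈ -H, the coset t^l H is H for even l and -H for odd l, in step with a^l = (-1)^l.
-- So the arc condition of G(3q;r,2,u) reads y − x ∈ H for j = i + 1 and x − y ∈ H for i = j + 1,
-- which is the one of G(3q,r).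
-- For u = lcm(r, o(t)), write t = -h with h ∈ H, so that h^r = 1.
-- If r is even then -1 ∈ H: otherwise 1 would be the only fixed point of inversion on H, because q is prime,
-- and |H| would be odd.  Hence t ∈ H and o(t) divides r.
-- If r is odd then t^r = -1, so o(t) is even and divides 2r.
module Submission where

open import Defs
open import Algebra.Bundles using (CommutativeMonoid; CommutativeRing; Monoid)
import Algebra.Properties.CommutativeMonoid.Mult as Mult
import Algebra.Properties.CommutativeMonoid.Sum as Sum
import Algebra.Properties.CommutativeSemigroup as CommutativeSemigroup
import Algebra.Properties.Monoid.Sum as MonoidSum
import Algebra.Properties.Ring as RingProperties
open import Data.Bool.Base using (if_then_else_; true; false)
open import Data.Empty using (⊥-elim)
open import Data.Fin using (Fin; toℕ; _<?_) renaming (_<_ to _<ᶠ_)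
open import Data.Fin.Patterns using (0F; 1F; 2F)
open import Data.Fin.Permutation using (Permutation; permutation)
open import Data.Fin.Properties using (toℕ-fromℕ<; toℕ-injective; toℕ<n; <-cmp)
open import Data.Fin.Subset using (Subset; _∈_; _∉_; ∣_∣; ⁅_⁆; inside; outside)
open import Data.Fin.Subset.Properties using (_∈?_; x∈⁅x⁆; x∈⁅y⁆⇒x≡y; ∣⁅x⁆∣≡1)
open import Data.Integer using (ℤ; +_; -[1+_])
open import Data.Nat using (ℕ; zero; suc; _+_; _*_; _∸_; _<_; _≤_; NonZero; z≤n; s≤s)
open import Data.Nat.DivMod
open import Data.Nat.Divisibility
open import Data.Nat.LCM using (lcm; m∣lcm[m,n]; n∣lcm[m,n]; lcm-least)
open import Data.Nat.Primality using (Prime; prime[2]; prime?; euclidsLemma)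
open import Data.Nat.Properties hiding (_<?_; <-cmp)
open import Data.Product using (∃-syntax; _×_; _,_; proj₁; proj₂)
open import Data.Sum using (_⊎_; inj₁; inj₂; [_,_]′)
open import Data.Vec.Base using ([]; _∷_; here; there)
open import Function.Base using (_∘_)
open import Function.Bundles using (mk⇔; module Equivalence)
open import Level using (0ℓ)
open import Relation.Binary.Core using (_⇔_)
open import Relation.Binary.Definitions using (Tri; tri<; tri≈; tri>)
open import Relation.Binary.PropositionalEquality
open import Relation.Nullary using (¬_; Dec; yes; no; does; contradiction)
open import Relation.Nullary.Decidable using (from-yes; dec-true; dec-false; does-⇔)

open Unit

-- Residues

module _ {n : ℕ} .{{_ : NonZero n}} where

  open ≡-Reasoning

  0ₙ : Fin n
  0ₙ = 0 mod n

  mod-cong : ∀ {m k} → m % n ≡ k % n → m mod n ≡ k mod n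
  mod-cong eq =
    toℕ-injective (trans (toℕ-fromℕ< _) (trans eq (sym (toℕ-fromℕ< _))))

  mod-injective : ∀ {m k} → m mod n ≡ k mod n → m % n ≡ k % n
  mod-injective eq =
    trans (sym (toℕ-fromℕ< _)) (trans (cong toℕ eq) (toℕ-fromℕ< _))

  mod-toℕ : ∀ x → toℕ x mod n ≡ x
  mod-toℕ x = toℕ-injective (trans (toℕ-fromℕ< _) (m<n⇒m%n≡m (toℕ<n x)))

  mod-+ : ∀ m k → m mod n +ₙ k mod n ≡ (m + k) mod n
  mod-+ m k = trans
    (cong₂ (λ a b → (a + b) mod n) (toℕ-fromℕ< (m%n<n m n)) (toℕ-fromℕ< (m%n<n k n)))
    (mod-cong (sym (%-distribˡ-+ m k n)))

  mod-* : ∀ m k → m mod n *ₙ (k mod n) ≡ (m * k) mod n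
  mod-* m k = trans
    (cong₂ (λ a b → (a * b) mod n) (toℕ-fromℕ< (m%n<n m n)) (toℕ-fromℕ< (m%n<n k n)))
    (mod-cong (sym (%-distribˡ-* m k n)))

  mod-+ˡ : ∀ m x → m mod n +ₙ x ≡ (m + toℕ x) mod n
  mod-+ˡ m x = trans (cong (m mod n +ₙ_) (sym (mod-toℕ x))) (mod-+ m (toℕ x))

  mod-+ʳ : ∀ x m → x +ₙ m mod n ≡ (toℕ x + m) mod n
  mod-+ʳ x m = trans (cong (_+ₙ m mod n) (sym (mod-toℕ x))) (mod-+ (toℕ x) m)

  mod-*ˡ : ∀ m x → m mod n *ₙ x ≡ (m * toℕ x) mod n
  mod-*ˡ m x = trans (cong (m mod n *ₙ_) (sym (mod-toℕ x))) (mod-* m (toℕ x))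

  mod-*ʳ : ∀ x m → x *ₙ (m mod n) ≡ (toℕ x * m) mod n
  mod-*ʳ x m = trans (cong (_*ₙ (m mod n)) (sym (mod-toℕ x))) (mod-* (toℕ x) m)

  +ₙ-comm : ∀ x y → x +ₙ y ≡ y +ₙ x
  +ₙ-comm x y = cong (_mod n) (+-comm (toℕ x) (toℕ y))

  +ₙ-assoc : ∀ x y z → (x +ₙ y) +ₙ z ≡ x +ₙ (y +ₙ z)
  +ₙ-assoc x y z = begin
    (x +ₙ y) +ₙ z                   ≡⟨ mod-+ˡ _ z ⟩
    (toℕ x + toℕ y + toℕ z) mod n   ≡⟨ cong (_mod n) (+-assoc (toℕ x) _ _) ⟩
    (toℕ x + (toℕ y + toℕ z)) mod n ≡⟨ mod-+ʳ x _ ⟨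
    x +ₙ (y +ₙ z)                   ∎

  +ₙ-identityˡ : ∀ x → 0ₙ +ₙ x ≡ x
  +ₙ-identityˡ x = trans (mod-+ˡ 0 x) (mod-toℕ x)

  -ₙ-inverseˡ : ∀ x → -ₙ x +ₙ x ≡ 0ₙ
  -ₙ-inverseˡ x = begin
    -ₙ x +ₙ x                 ≡⟨ mod-+ˡ _ x ⟩
    (n ∸ toℕ x + toℕ x) mod n ≡⟨ cong (_mod n) (m∸n+n≡m (<⇒≤ (toℕ<n x))) ⟩
    n mod n                   ≡⟨ mod-cong ([m+n]%n≡m%n 0 n) ⟩
    0ₙ                        ∎

  *ₙ-comm : ∀ x y → x *ₙ y ≡ y *ₙ x
  *ₙ-comm x y = cong (_mod n) (*-comm (toℕ x) (toℕ y))

  *ₙ-assoc : ∀ x y z → (x *ₙ y) *ₙ z ≡ x *ₙ (y *ₙ z)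
  *ₙ-assoc x y z = begin
    (x *ₙ y) *ₙ z                   ≡⟨ mod-*ˡ _ z ⟩
    (toℕ x * toℕ y * toℕ z) mod n   ≡⟨ cong (_mod n) (*-assoc (toℕ x) _ _) ⟩
    (toℕ x * (toℕ y * toℕ z)) mod n ≡⟨ mod-*ʳ x _ ⟨
    x *ₙ (y *ₙ z)                   ∎

  *ₙ-identityˡ : ∀ x → 1ₙ *ₙ x ≡ x
  *ₙ-identityˡ x = begin
    1ₙ *ₙ x           ≡⟨ mod-*ˡ 1 x ⟩
    (1 * toℕ x) mod n ≡⟨ cong (_mod n) (*-identityˡ (toℕ x)) ⟩
    toℕ x mod n       ≡⟨ mod-toℕ x ⟩
    x                 ∎

  *ₙ-identityʳ : ∀ x → x *ₙ 1ₙ ≡ x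
  *ₙ-identityʳ x = trans (*ₙ-comm x 1ₙ) (*ₙ-identityˡ x)

  *ₙ-distribˡ-+ₙ : ∀ x y z → x *ₙ (y +ₙ z) ≡ x *ₙ y +ₙ x *ₙ z
  *ₙ-distribˡ-+ₙ x y z = begin
    x *ₙ (y +ₙ z)                           ≡⟨ mod-*ʳ x _ ⟩
    (toℕ x * (toℕ y + toℕ z)) mod n         ≡⟨ cong (_mod n) (*-distribˡ-+ (toℕ x) _ _) ⟩
    (toℕ x * toℕ y + toℕ x * toℕ z) mod n   ≡⟨ mod-+ (toℕ x * toℕ y) (toℕ x * toℕ z) ⟨
    x *ₙ y +ₙ x *ₙ z                        ∎

ℤ/ : (n : ℕ) .{{_ : NonZero n}} → CommutativeRing 0ℓ 0ℓ
ℤ/ n = record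
  { Carrier           = Fin n
  ; _≈_               = _≡_
  ; _+_               = _+ₙ_
  ; _*_               = _*ₙ_
  ; -_                = -ₙ_
  ; 0#                = 0ₙ
  ; 1#                = 1ₙ
  ; isCommutativeRing = record
    { isRing = record
      { +-isAbelianGroup = record
        { isGroup = record
          { isMonoid = record
            { isSemigroup = record
              { isMagma = isMagma _+ₙ_
              ; assoc   = +ₙ-assoc
              }
            ; identity = +ₙ-identityˡ , λ x → trans (+ₙ-comm x _) (+ₙ-identityˡ x)
            }
          ; inverse = -ₙ-inverseˡ , λ x → trans (+ₙ-comm x _) (-ₙ-inverseˡ x)
          ; ⁻¹-cong = cong λ x → -ₙ x
          }
        ; comm = +ₙ-comm
        }
      ; *-cong     = cong₂ _*ₙ_
      ; *-assoc    = *ₙ-assoc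
      ; *-identity = *ₙ-identityˡ , *ₙ-identityʳ
      ; distrib    = *ₙ-distribˡ-+ₙ , λ x y z → trans (*ₙ-comm _ x)
          (trans (*ₙ-distribˡ-+ₙ x y z) (cong₂ _+ₙ_ (*ₙ-comm x y) (*ₙ-comm x z)))
      }
    ; *-comm = *ₙ-comm
    }
  }

-- Differences, powers, orders and signs in ℤ_n

module _ {n : ℕ} .{{_ : NonZero n}} where

  private
    module R = CommutativeRing (ℤ/ n)
    module RP = RingProperties R.ring
    module M = Mult R.*-commutativeMonoid

  open ≡-Reasoning

  x-y≡x+[-y] : (x y : Fin n) → x -ₙ y ≡ x +ₙ -ₙ y
  x-y≡x+[-y] x y = sym (mod-+ʳ x (n ∸ toℕ y))

  -[x-y]≡y-x : (x y : Fin n) → -ₙ (x -ₙ y) ≡ y -ₙ x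
  -[x-y]≡y-x x y = begin
    -ₙ (x -ₙ y)    ≡⟨ R.-‿cong (x-y≡x+[-y] x y) ⟩
    -ₙ (x +ₙ -ₙ y) ≡⟨ RP.⁻¹-anti-homo‿- x y ⟩
    y +ₙ -ₙ x      ≡⟨ x-y≡x+[-y] y x ⟨
    y -ₙ x         ∎

  y-x≡-z⇒x-y≡z : (x y : Fin n) {z : Fin n} → y -ₙ x ≡ -ₙ z → x -ₙ y ≡ z
  y-x≡-z⇒x-y≡z x y {z} eq =
    trans (sym (-[x-y]≡y-x y x)) (trans (R.-‿cong eq) (RP.-‿involutive z))

  x-y≡z⇒x≡y+z : (x y : Fin n) {z : Fin n} → x -ₙ y ≡ z → x ≡ y +ₙ z
  x-y≡z⇒x≡y+z x y refl = begin
    x                    ≡⟨ RP.xyx⁻¹≈y y x ⟨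
    (y +ₙ x) +ₙ -ₙ y     ≡⟨ +ₙ-assoc y x (-ₙ y) ⟩
    y +ₙ (x +ₙ -ₙ y)     ≡⟨ cong (y +ₙ_) (x-y≡x+[-y] x y) ⟨
    y +ₙ (x -ₙ y)        ∎

  y+z-y≡z : (y z : Fin n) → (y +ₙ z) -ₙ y ≡ z
  y+z-y≡z y z = trans (x-y≡x+[-y] (y +ₙ z) y) (RP.xyx⁻¹≈y y z)

  ^ₙ≡× : ∀ (x : Fin n) k → x ^ₙ k ≡ k M.× x
  ^ₙ≡× x zero    = refl
  ^ₙ≡× x (suc k) = cong (x *ₙ_) (^ₙ≡× x k)

  ^ₙ-+ : ∀ (x : Fin n) m k → x ^ₙ (m + k) ≡ x ^ₙ m *ₙ x ^ₙ k
  ^ₙ-+ x m k rewrite ^ₙ≡× x (m + k) | ^ₙ≡× x m | ^ₙ≡× x k = M.×-homo-+ x m k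

  ^ₙ-* : ∀ (x : Fin n) m k → x ^ₙ (m * k) ≡ (x ^ₙ k) ^ₙ m
  ^ₙ-* x m k rewrite ^ₙ≡× (x ^ₙ k) m | ^ₙ≡× x k | ^ₙ≡× x (m * k) = sym (M.×-assocˡ x m k)

  *ₙ-^ₙ : ∀ (x y : Fin n) k → (x *ₙ y) ^ₙ k ≡ x ^ₙ k *ₙ y ^ₙ k
  *ₙ-^ₙ x y k rewrite ^ₙ≡× (x *ₙ y) k | ^ₙ≡× x k | ^ₙ≡× y k = M.×-distrib-+ x y k

  1-^ₙ : ∀ k → 1ₙ {n} ^ₙ k ≡ 1ₙ
  1-^ₙ zero    = refl
  1-^ₙ (suc k) = trans (*ₙ-identityˡ _) (1-^ₙ k)

  -- Divide `k` by `o`: since `t ^ o = 1`, the remainder is again an exponent that gives 1. It is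
  -- smaller than `o`, so minimality of the order forces it to be 0.
  ^ₙ-order-∣ : ∀ {o} (t : Unit n) → IsOrderOf o t → ∀ k → val t ^ₙ k ≡ 1ₙ → o ∣ k
  ^ₙ-order-∣ {suc o-1} t (_ , t^o≡1 , least) k t^k≡1
    with k % suc o-1 in eq
  ... | zero  = m%n≡0⇒n∣m k (suc o-1) eq
  ... | suc j = contradiction (least (suc j) (s≤s z≤n) t^j≡1)
                  (<⇒≱ (subst (_< suc o-1) eq (m%n<n k (suc o-1))))
    where
    o = suc o-1
    t^j≡1 : val t ^ₙ suc j ≡ 1ₙ
    t^j≡1 = begin
      val t ^ₙ suc j                          ≡⟨ *ₙ-identityʳ _ ⟨
      val t ^ₙ suc j *ₙ 1ₙ                    ≡⟨ cong (val t ^ₙ suc j *ₙ_) (1-^ₙ (k / o)) ⟨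
      val t ^ₙ suc j *ₙ 1ₙ ^ₙ (k / o)         ≡⟨ cong (λ z → val t ^ₙ suc j *ₙ z ^ₙ (k / o)) t^o≡1 ⟨
      val t ^ₙ suc j *ₙ (val t ^ₙ o) ^ₙ (k / o) ≡⟨ cong (val t ^ₙ suc j *ₙ_) (^ₙ-* (val t) (k / o) o) ⟨
      val t ^ₙ suc j *ₙ val t ^ₙ (k / o * o)  ≡⟨ ^ₙ-+ (val t) (suc j) _ ⟨
      val t ^ₙ (suc j + k / o * o)            ≡⟨ cong (λ i → val t ^ₙ (i + k / o * o)) eq ⟨
      val t ^ₙ (k % o + k / o * o)            ≡⟨ cong (val t ^ₙ_) (m≡m%n+[m/n]*n k o) ⟨
      val t ^ₙ k                              ≡⟨ t^k≡1 ⟩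
      1ₙ                                      ∎

  -x*-y≡x*y : (x y : Fin n) → -ₙ x *ₙ -ₙ y ≡ x *ₙ y
  -x*-y≡x*y x y = begin
    -ₙ x *ₙ -ₙ y     ≡⟨ RP.-‿distribˡ-* x (-ₙ y) ⟨
    -ₙ (x *ₙ -ₙ y)   ≡⟨ R.-‿cong (RP.-‿distribʳ-* x y) ⟨
    -ₙ (-ₙ (x *ₙ y)) ≡⟨ RP.-‿involutive _ ⟩
    x *ₙ y           ∎

  -1*-1≡1 : -ₙ 1ₙ {n} *ₙ -ₙ 1ₙ ≡ 1ₙ
  -1*-1≡1 = trans (-x*-y≡x*y 1ₙ 1ₙ) (*ₙ-identityˡ 1ₙ)

  -1^even≡1 : ∀ {m} → 2 ∣ m → (-ₙ 1ₙ {n}) ^ₙ m ≡ 1ₙ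
  -1^even≡1 (divides k refl) = begin
    (-ₙ 1ₙ) ^ₙ (k * 2)      ≡⟨ ^ₙ-* (-ₙ 1ₙ) k 2 ⟩
    ((-ₙ 1ₙ) ^ₙ 2) ^ₙ k     ≡⟨ cong (λ z → (-ₙ 1ₙ *ₙ z) ^ₙ k) (*ₙ-identityʳ (-ₙ 1ₙ)) ⟩
    (-ₙ 1ₙ *ₙ -ₙ 1ₙ) ^ₙ k   ≡⟨ cong (_^ₙ k) -1*-1≡1 ⟩
    1ₙ ^ₙ k                 ≡⟨ 1-^ₙ k ⟩
    1ₙ                      ∎

  -1^odd≡-1 : ∀ {m} → ¬ 2 ∣ m → (-ₙ 1ₙ {n}) ^ₙ m ≡ -ₙ 1ₙ
  -1^odd≡-1 {zero}  odd = contradiction (2 ∣0) odd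
  -1^odd≡-1 {suc m} odd = trans (cong (-ₙ 1ₙ *ₙ_) (-1^even≡1 (pred-even m odd))) (*ₙ-identityʳ _)
    where
    pred-even : ∀ m → ¬ 2 ∣ suc m → 2 ∣ m
    pred-even zero          _   = 2 ∣0
    pred-even (suc zero)    odd = contradiction ∣-refl odd
    pred-even (suc (suc m)) odd = ∣m∣n⇒∣m+n ∣-refl (pred-even m (odd ∘ ∣m∣n⇒∣m+n ∣-refl))

  inverse-unique : ∀ {x y z : Fin n} → x *ₙ y ≡ 1ₙ → x *ₙ z ≡ 1ₙ → y ≡ z
  inverse-unique {x} {y} {z} xy≡1 xz≡1 = begin
    y              ≡⟨ *ₙ-identityʳ y ⟨
    y *ₙ 1ₙ        ≡⟨ cong (y *ₙ_) xz≡1 ⟨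
    y *ₙ (x *ₙ z)  ≡⟨ *ₙ-assoc y x z ⟨
    y *ₙ x *ₙ z    ≡⟨ cong (_*ₙ z) (trans (*ₙ-comm y x) xy≡1) ⟩
    1ₙ *ₙ z        ≡⟨ *ₙ-identityˡ z ⟩
    z              ∎

  -- Equality would give 2 = 1 + 1 = 0 modulo `n`.
  1≢-1 : 2 < n → 1ₙ {n} ≢ -ₙ 1ₙ
  1≢-1 2<n 1≡-1 = contradiction (trans (sym (m<n⇒m%n≡m 2<n)) (trans (mod-injective 2≡0) (m*n%n≡0 0 n))) λ()
    where
    2≡0 : 2 mod n ≡ 0 mod n
    2≡0 = begin
      2 mod n       ≡⟨ mod-+ 1 1 ⟨
      1ₙ +ₙ 1ₙ      ≡⟨ cong (_+ₙ 1ₙ) 1≡-1 ⟩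
      -ₙ 1ₙ +ₙ 1ₙ   ≡⟨ -ₙ-inverseˡ 1ₙ ⟩
      0ₙ            ∎

  -- Euclid's lemma, applied to the representatives in ℕ.
  noZeroDivisors : Prime n → ∀ {x y : Fin n} → x *ₙ y ≡ 0ₙ → x ≡ 0ₙ ⊎ y ≡ 0ₙ
  noZeroDivisors pn {x} {y} xy≡0 =
    [ inj₁ ∘ n∣⇒≡0 x , inj₂ ∘ n∣⇒≡0 y ]′
      (euclidsLemma (toℕ x) (toℕ y) pn
        (m%n≡0⇒n∣m _ n (trans (mod-injective xy≡0) (m*n%n≡0 0 n))))
    where
    n∣⇒≡0 : ∀ z → n ∣ toℕ z → z ≡ 0ₙ
    n∣⇒≡0 z n∣z = trans (sym (mod-toℕ z))
      (mod-cong (trans (n∣m⇒m%n≡0 _ n n∣z) (sym (m*n%n≡0 0 n))))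

  -- The product (x - 1)(x + 1) = x² - 1 vanishes, and ℤ_n has no zero divisors for prime `n`.
  x²≡1⇒x≡±1 : Prime n → ∀ {x : Fin n} → x *ₙ x ≡ 1ₙ → x ≡ 1ₙ ⊎ x ≡ -ₙ 1ₙ
  x²≡1⇒x≡±1 pn {x} x²≡1 =
    [ inj₁ ∘ RP.x∙y⁻¹≈ε⇒x≈y x 1ₙ
    , inj₂ ∘ RP.+-inverseˡ-unique x 1ₙ ]′ (noZeroDivisors pn [x-1][x+1]≡0)
    where
    [x-1][x+1]≡0 : (x +ₙ -ₙ 1ₙ) *ₙ (x +ₙ 1ₙ) ≡ 0ₙ
    [x-1][x+1]≡0 = begin
      (x +ₙ -ₙ 1ₙ) *ₙ (x +ₙ 1ₙ)
        ≡⟨ R.distribʳ (x +ₙ 1ₙ) x (-ₙ 1ₙ) ⟩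
      x *ₙ (x +ₙ 1ₙ) +ₙ -ₙ 1ₙ *ₙ (x +ₙ 1ₙ)
        ≡⟨ cong₂ _+ₙ_ (R.distribˡ x x 1ₙ) (RP.-1*x≈-x (x +ₙ 1ₙ)) ⟩
      (x *ₙ x +ₙ x *ₙ 1ₙ) +ₙ -ₙ (x +ₙ 1ₙ)
        ≡⟨ cong (_+ₙ -ₙ (x +ₙ 1ₙ)) (cong₂ _+ₙ_ x²≡1 (*ₙ-identityʳ x)) ⟩
      (1ₙ +ₙ x) +ₙ -ₙ (x +ₙ 1ₙ)
        ≡⟨ RP.x≈y⇒x∙y⁻¹≈ε (+ₙ-comm 1ₙ x) ⟩
      0ₙ ∎

-- Finite subgroups

module _ {c ℓ} (M : Monoid c ℓ) where

  open Monoid M using (Carrier; ε; _≈_; ∙-congˡ) renaming (refl to ≈-refl; trans to ≈-trans; identityˡ to idˡ)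
  open MonoidSum M using (sum)
  open import Algebra.Properties.Monoid.Mult M using () renaming (_×_ to _·_)

  -- Stated for any monoid because it serves twice: multiplicatively in ℤ_n it yields the power
  -- `t ^ ∣ H ∣`, and in (ℕ, +) with `x = 1` it counts a subset.
  sum-indicator : ∀ {n} (p : Subset n) (x : Carrier) →
    sum (λ i → if does (i ∈? p) then x else ε) ≈ ∣ p ∣ · x
  sum-indicator []           x = ≈-refl
  sum-indicator (inside  ∷ p) x = ∙-congˡ (sum-indicator p x)
  sum-indicator (outside ∷ p) x = ≈-trans (idˡ _) (sum-indicator p x)

module _ {n : ℕ} .{{_ : NonZero n}} {H : Subset n} {r : ℕ} (H-subgroup : IsUnitSubgroup H r) where

  open IsUnitSubgroup H-subgroup
  open ≡-Reasoning

  private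
    module R = CommutativeRing (ℤ/ n)
    module RP = RingProperties R.ring
    module M = Mult R.*-commutativeMonoid
    module Π = Sum R.*-commutativeMonoid
    module Σ = Sum +-0-commutativeMonoid
    module S = CommutativeSemigroup
      (CommutativeMonoid.commutativeSemigroup R.*-commutativeMonoid)

  product-∈ : ∀ {m} (f : Fin m → Fin n) → (∀ i → f i ∈ H) → Π.sum f ∈ H
  product-∈ {zero}  f f∈H = has-one
  product-∈ {suc m} f f∈H = closed (f∈H Fin.zero) (product-∈ (f ∘ Fin.suc) (f∈H ∘ Fin.suc))

  inverse-∈ : ∀ {x y} → x ∈ H → x *ₙ y ≡ 1ₙ → y ∈ H
  inverse-∈ {x} x∈H xy≡1 with has-inverses x∈H
  ... | z , z∈H , xz≡1 = subst (_∈ H) (inverse-unique {x = x} xz≡1 xy≡1) z∈H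

  -- Multiplication by t permutes H, so the product P of H satisfies P = t ^ r · P.
  t^r≡1 : ∀ {t} → t ∈ H → t ^ₙ r ≡ 1ₙ
  t^r≡1 {t} t∈H with has-inverses t∈H
  ... | t⁻¹ , t⁻¹∈H , tt⁻¹≡1 = begin
    t ^ₙ r                  ≡⟨ *ₙ-identityʳ _ ⟨
    t ^ₙ r *ₙ 1ₙ            ≡⟨ cong (t ^ₙ r *ₙ_) PP⁻¹≡1 ⟨
    t ^ₙ r *ₙ (P *ₙ P⁻¹)    ≡⟨ *ₙ-assoc (t ^ₙ r) P P⁻¹ ⟨
    (t ^ₙ r *ₙ P) *ₙ P⁻¹    ≡⟨ cong (_*ₙ P⁻¹) P≡t^r*P ⟨
    P *ₙ P⁻¹                ≡⟨ PP⁻¹≡1 ⟩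
    1ₙ                      ∎
    where
    -- Factors off `H` are set to 1, so a product over all residues is a product over `H`, and a
    -- permutation of the whole of ℤ_n can reindex it.
    on-H : (Fin n → Fin n) → Fin n → Fin n
    on-H f x = if does (x ∈? H) then f x else 1ₙ

    P : Fin n
    P = Π.sum (on-H λ x → x)

    P∈H : P ∈ H
    P∈H = product-∈ (on-H λ x → x) member
      where
      member : ∀ x → on-H (λ x → x) x ∈ H
      member x with x ∈? H
      ... | yes x∈H = x∈H
      ... | no  _   = has-one

    P⁻¹ = proj₁ (has-inverses P∈H)
    PP⁻¹≡1 = proj₂ (proj₂ (has-inverses P∈H))

    t⁻¹[tx]≡x : ∀ x → t⁻¹ *ₙ (t *ₙ x) ≡ x
    t⁻¹[tx]≡x x = begin
      t⁻¹ *ₙ (t *ₙ x) ≡⟨ *ₙ-assoc t⁻¹ t x ⟨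
      t⁻¹ *ₙ t *ₙ x   ≡⟨ cong (_*ₙ x) (trans (*ₙ-comm t⁻¹ t) tt⁻¹≡1) ⟩
      1ₙ *ₙ x         ≡⟨ *ₙ-identityˡ x ⟩
      x               ∎

    t[t⁻¹x]≡x : ∀ x → t *ₙ (t⁻¹ *ₙ x) ≡ x
    t[t⁻¹x]≡x x = trans (S.x∙yz≈y∙xz t t⁻¹ x) (t⁻¹[tx]≡x x)

    π : Permutation n n
    π = permutation (t *ₙ_) (t⁻¹ *ₙ_) t[t⁻¹x]≡x t⁻¹[tx]≡x

    tx∈?H : ∀ x → does (t *ₙ x ∈? H) ≡ does (x ∈? H)
    tx∈?H x = does-⇔ (mk⇔ (λ tx∈H → subst (_∈ H) (t⁻¹[tx]≡x x) (closed t⁻¹∈H tx∈H))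
                          (closed t∈H))
                     (t *ₙ x ∈? H) (x ∈? H)

    split : ∀ x → on-H (λ x → x) (t *ₙ x) ≡ on-H (λ _ → t) x *ₙ on-H (λ x → x) x
    split x rewrite tx∈?H x with does (x ∈? H)
    ... | true  = refl
    ... | false = sym (*ₙ-identityˡ 1ₙ)

    P≡t^r*P : P ≡ t ^ₙ r *ₙ P
    P≡t^r*P = begin
      P
        ≡⟨ Π.sum-permute (on-H λ x → x) π ⟩
      Π.sum (λ x → on-H (λ x → x) (t *ₙ x))
        ≡⟨ Π.sum-cong-≗ split ⟩
      Π.sum (λ x → on-H (λ _ → t) x *ₙ on-H (λ x → x) x)
        ≡⟨ Π.∑-distrib-+ (on-H λ _ → t) (on-H λ x → x) ⟩
      Π.sum (on-H λ _ → t) *ₙ P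
        ≡⟨ cong (_*ₙ P) (sum-indicator R.*-monoid H t) ⟩
      ∣ H ∣ M.× t *ₙ P
        ≡⟨ cong (_*ₙ P) (^ₙ≡× t ∣ H ∣) ⟨
      t ^ₙ ∣ H ∣ *ₙ P
        ≡⟨ cong (λ k → t ^ₙ k *ₙ P) order ⟩
      t ^ₙ r *ₙ P ∎

  -- If -1 is not in `H`, split `H` into the elements below their inverse, those above it, and those
  -- equal to it. Inversion swaps the first two classes, and the third is {1}, so `r = (L + L) + 1`.
  even-order⇒-1∈H : Prime n → 2 ∣ r → -ₙ 1ₙ ∈ H
  even-order⇒-1∈H pn 2∣r with -ₙ 1ₙ ∈? H
  ... | yes -1∈H = -1∈H
  -- 2 would divide both `(L + L) + 1` and `L + L`, hence 1.
  ... | no  -1∉H = contradiction (∣m+n∣m⇒∣n 2∣L+L+1 2∣L+L) λ { (divides (suc _) ()) }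
    where
    -- Inversion on `H`, extended by the identity to an involution of all residues; a residue off
    -- `H` is a fixed point and so contributes to neither strict comparison.
    σ : Fin n → Fin n
    σ x with x ∈? H
    ... | yes x∈H = proj₁ (has-inverses x∈H)
    ... | no  _   = x

    σ-∉ : ∀ {x} → x ∉ H → σ x ≡ x
    σ-∉ {x} x∉H with x ∈? H
    ... | yes x∈H = contradiction x∈H x∉H
    ... | no  _   = refl

    x*σx≡1 : ∀ {x} → x ∈ H → x *ₙ σ x ≡ 1ₙ
    x*σx≡1 {x} x∈H with x ∈? H
    ... | yes x∈H = proj₂ (proj₂ (has-inverses x∈H))
    ... | no  x∉H = contradiction x∈H x∉H

    σ-involutive : ∀ x → σ (σ x) ≡ x
    σ-involutive x = by-cases (x ∈? H)
      where
      by-cases : Dec (x ∈ H) → σ (σ x) ≡ x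
      by-cases (no  x∉H) = trans (cong σ (σ-∉ x∉H)) (σ-∉ x∉H)
      by-cases (yes x∈H) = inverse-unique {x = σ x}
        (x*σx≡1 (inverse-∈ x∈H (x*σx≡1 x∈H)))
        (trans (*ₙ-comm (σ x) x) (x*σx≡1 x∈H))

    fixed⇒≡1 : ∀ {x} → x ∈ H → σ x ≡ x → x ≡ 1ₙ
    fixed⇒≡1 {x} x∈H σx≡x
      with x²≡1⇒x≡±1 pn {x} (trans (cong (x *ₙ_) (sym σx≡x)) (x*σx≡1 x∈H))
    ... | inj₁ x≡1  = x≡1
    ... | inj₂ x≡-1 = contradiction (subst (_∈ H) x≡-1 x∈H) -1∉H

    σ1≡1 : σ 1ₙ ≡ 1ₙ
    σ1≡1 = trans (sym (*ₙ-identityˡ (σ 1ₙ))) (x*σx≡1 has-one)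

    count : ∀ {A : Set} → Dec A → ℕ
    count A? = if does A? then 1 else 0

    L : ℕ
    L = Σ.sum (λ x → count (x <? σ x))

    -- Reindexing by `σ` turns `x < σ x` into `σ x < σ (σ x)`, and `σ (σ x)` is `x`.
    L≡greater : L ≡ Σ.sum (λ x → count (σ x <? x))
    L≡greater = trans
      (Σ.sum-permute (λ x → count (x <? σ x)) (permutation σ σ σ-involutive σ-involutive))
      (Σ.sum-cong-≗ (λ x → cong (λ y → count (σ x <? y)) (σ-involutive x)))

    Trichotomy : Fin n → Set
    Trichotomy x = count (x ∈? H) ≡
      (count (x <? σ x) + count (σ x <? x)) + count (x ∈? ⁅ 1ₙ ⁆)

    -- On `H` exactly one of the three counts is 1, a fixed point being 1 itself. Off `H` all counts
    -- vanish: `σ` fixes `x`, and `x` differs from 1 because 1 lies in `H`.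
    trichotomy : ∀ x → Trichotomy x
    trichotomy x = by-cases (x ∈? H) (<-cmp x (σ x))
      where
      x∉⁅1⁆ : σ x ≢ x → x ∉ ⁅ 1ₙ ⁆
      x∉⁅1⁆ σx≢x x∈⁅1⁆ = σx≢x (subst (λ z → σ z ≡ z) (sym (x∈⁅y⁆⇒x≡y 1ₙ x∈⁅1⁆)) σ1≡1)
      by-cases : Dec (x ∈ H) → Tri (x <ᶠ σ x) (x ≡ σ x) (σ x <ᶠ x) → Trichotomy x
      by-cases (no x∉H) _
        rewrite σ-∉ x∉H
              | dec-false (x ∈? H) x∉H
              | dec-false (x <? x) (<-irrefl refl)
              | dec-false (x ∈? ⁅ 1ₙ ⁆) (λ x∈ → x∉H (subst (_∈ H) (sym (x∈⁅y⁆⇒x≡y 1ₙ x∈)) has-one))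
              = refl
      by-cases (yes x∈H) (tri< x<σx σx≢x σx≮x)
        rewrite dec-true (x ∈? H) x∈H
              | dec-true (x <? σ x) x<σx
              | dec-false (σ x <? x) σx≮x
              | dec-false (x ∈? ⁅ 1ₙ ⁆) (x∉⁅1⁆ (σx≢x ∘ sym))
              = refl
      by-cases (yes x∈H) (tri> x≮σx σx≢x σx<x)
        rewrite dec-true (x ∈? H) x∈H
              | dec-false (x <? σ x) x≮σx
              | dec-true (σ x <? x) σx<x
              | dec-false (x ∈? ⁅ 1ₙ ⁆) (x∉⁅1⁆ (σx≢x ∘ sym))
              = refl
      by-cases (yes x∈H) (tri≈ x≮σx x≡σx σx≮x)
        rewrite dec-true (x ∈? H) x∈H
              | dec-false (x <? σ x) x≮σx
              | dec-false (σ x <? x) σx≮x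
              | dec-true (x ∈? ⁅ 1ₙ ⁆)
                  (subst (_∈ ⁅ 1ₙ ⁆) (sym (fixed⇒≡1 x∈H (sym x≡σx))) (x∈⁅x⁆ 1ₙ))
              = refl

    ∑-count : ∀ (p : Subset n) → Σ.sum (λ x → count (x ∈? p)) ≡ ∣ p ∣
    ∑-count p = trans (sum-indicator +-0-monoid p 1) (×1 ∣ p ∣)
      where
      open import Algebra.Properties.Monoid.Mult +-0-monoid using () renaming (_×_ to _·_)
      ×1 : ∀ k → k · 1 ≡ k
      ×1 zero    = refl
      ×1 (suc k) = cong suc (×1 k)

    r≡L+L+1 : r ≡ (L + L) + 1
    r≡L+L+1 = begin
      r
        ≡⟨ order ⟨
      ∣ H ∣
        ≡⟨ ∑-count H ⟨
      Σ.sum (λ x → count (x ∈? H))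
        ≡⟨ Σ.sum-cong-≗ trichotomy ⟩
      Σ.sum (λ x → (count (x <? σ x) + count (σ x <? x)) + count (x ∈? ⁅ 1ₙ ⁆))
        ≡⟨ Σ.∑-distrib-+ (λ x → count (x <? σ x) + count (σ x <? x)) _ ⟩
      Σ.sum (λ x → count (x <? σ x) + count (σ x <? x)) + Σ.sum (λ x → count (x ∈? ⁅ 1ₙ ⁆))
        ≡⟨ cong₂ _+_ (Σ.∑-distrib-+ (λ x → count (x <? σ x)) _) (trans (∑-count ⁅ 1ₙ ⁆) (∣⁅x⁆∣≡1 1ₙ)) ⟩
      (L + Σ.sum (λ x → count (σ x <? x))) + 1
        ≡⟨ cong (λ k → (L + k) + 1) L≡greater ⟨
      (L + L) + 1 ∎

    2∣L+L+1 : 2 ∣ (L + L) + 1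
    2∣L+L+1 = subst (2 ∣_) r≡L+L+1 2∣r

    2∣L+L : 2 ∣ L + L
    2∣L+L = divides L (trans (cong (λ k → L + k) (sym (+-identityʳ L))) (*-comm 2 L))

  -- The coset -H: the value of lcm(r, o(t)), and powers of a and t

  ∈-H⇒≡-1*h : ∀ {x} → x ∈- H → ∃[ h ] (h ∈ H × x ≡ -ₙ 1ₙ *ₙ h)
  ∈-H⇒≡-1*h (h , h∈H , refl) = h , h∈H , sym (RP.-1*x≈-x h)

  ∈-H⇒^r≡-1^r : ∀ {x} → x ∈- H → x ^ₙ r ≡ (-ₙ 1ₙ) ^ₙ r
  ∈-H⇒^r≡-1^r x∈-H with ∈-H⇒≡-1*h x∈-H
  ... | h , h∈H , refl = begin
    (-ₙ 1ₙ *ₙ h) ^ₙ r          ≡⟨ *ₙ-^ₙ (-ₙ 1ₙ) h r ⟩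
    (-ₙ 1ₙ) ^ₙ r *ₙ h ^ₙ r     ≡⟨ cong ((-ₙ 1ₙ) ^ₙ r *ₙ_) (t^r≡1 h∈H) ⟩
    (-ₙ 1ₙ) ^ₙ r *ₙ 1ₙ         ≡⟨ *ₙ-identityʳ _ ⟩
    (-ₙ 1ₙ) ^ₙ r               ∎

  -- Here -1 lies in `H`, hence so does `t`; then `t ^ r = 1` and `o` divides `r`.
  lcm[r,o]≡r : Prime n → 2 ∣ r → ∀ {o} (t : Unit n) → val t ∈- H → IsOrderOf o t → lcm r o ≡ r
  lcm[r,o]≡r pn 2∣r {o} t t∈-H t-order =
    ∣-antisym (lcm-least ∣-refl (^ₙ-order-∣ t t-order r t^r≡1′)) (m∣lcm[m,n] r o)
    where
    t^r≡1′ : val t ^ₙ r ≡ 1ₙ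
    t^r≡1′ with ∈-H⇒≡-1*h t∈-H
    ... | h , h∈H , eq = trans (cong (_^ₙ r) eq) (t^r≡1 (closed (even-order⇒-1∈H pn 2∣r) h∈H))

  -- From `t ^ r = -1` follows `t ^ (2 * r) = 1`, so `o` divides `2 * r` and the lcm does too.
  -- Conversely `o` is even and `r` is odd, so `2 * r` divides the lcm.
  lcm[r,o]≡2r : 2 < n → ¬ 2 ∣ r →
                ∀ {o} (t : Unit n) → val t ∈- H → IsOrderOf o t → lcm r o ≡ 2 * r
  lcm[r,o]≡2r 2<n r-odd {o} t t∈-H t-order = ∣-antisym
    (lcm-least {m = r} (n∣m*n 2) (^ₙ-order-∣ t t-order (2 * r) t^2r≡1))
    2r∣lcm
    where
    t^r≡-1 : val t ^ₙ r ≡ -ₙ 1ₙ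
    t^r≡-1 = trans (∈-H⇒^r≡-1^r t∈-H) (-1^odd≡-1 r-odd)

    t^2r≡1 : val t ^ₙ (2 * r) ≡ 1ₙ
    t^2r≡1 = begin
      val t ^ₙ (2 * r)   ≡⟨ ^ₙ-* (val t) 2 r ⟩
      (val t ^ₙ r) ^ₙ 2  ≡⟨ cong (_^ₙ 2) t^r≡-1 ⟩
      (-ₙ 1ₙ) ^ₙ 2       ≡⟨ -1^even≡1 ∣-refl ⟩
      1ₙ                 ∎

    2∣o : 2 ∣ o
    2∣o with 2 ∣? o
    ... | yes 2∣o   = 2∣o
    ... | no  o-odd = contradiction 1≡-1 (1≢-1 2<n)
      where
      -- Compute `t ^ (o * r)` in two ways: as a power of `t ^ o = 1`, and as an odd power of
      -- `t ^ r = -1`.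
      1≡-1 : 1ₙ ≡ -ₙ 1ₙ
      1≡-1 = begin
        1ₙ                  ≡⟨ 1-^ₙ r ⟨
        1ₙ ^ₙ r             ≡⟨ cong (_^ₙ r) (proj₁ (proj₂ t-order)) ⟨
        (val t ^ₙ o) ^ₙ r   ≡⟨ ^ₙ-* (val t) r o ⟨
        val t ^ₙ (r * o)    ≡⟨ cong (val t ^ₙ_) (*-comm r o) ⟩
        val t ^ₙ (o * r)    ≡⟨ ^ₙ-* (val t) o r ⟩
        (val t ^ₙ r) ^ₙ o   ≡⟨ cong (_^ₙ o) t^r≡-1 ⟩
        (-ₙ 1ₙ) ^ₙ o        ≡⟨ -1^odd≡-1 o-odd ⟩
        -ₙ 1ₙ               ∎

    -- The lcm is `k * r` and is even because `o` is. As 2 is prime and does not divide `r`, it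
    -- divides `k`.
    2r∣lcm : 2 * r ∣ lcm r o
    2r∣lcm with m∣lcm[m,n] r o
    ... | divides k lcm≡kr with euclidsLemma k r prime[2]
                                  (subst (2 ∣_) lcm≡kr (∣-trans 2∣o (n∣lcm[m,n] r o)))
    ...   | inj₁ 2∣k = subst (2 * r ∣_) (sym lcm≡kr) (*-monoˡ-∣ r 2∣k)
    ...   | inj₂ 2∣r = contradiction 2∣r r-odd

  -- Signed (a ^ l) (t ^ l) holds for all l: the powers of a and of t mod H run in step.
  Signed : Fin 3 → Fin n → Set
  Signed ε c = (ε ≡ 1ₙ × c ∈ H) ⊎ (ε ≡ -ₙ 1ₙ × c ∈- H)

  ∈H*∈-H : ∀ {x y} → x ∈ H → y ∈- H → x *ₙ y ∈- H
  ∈H*∈-H {x} x∈H (h , h∈H , refl) = x *ₙ h , closed x∈H h∈H , sym (RP.-‿distribʳ-* x h)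

  ∈-H*∈-H : ∀ {x y} → x ∈- H → y ∈- H → x *ₙ y ∈ H
  ∈-H*∈-H (g , g∈H , refl) (h , h∈H , refl) =
    subst (_∈ H) (sym (-x*-y≡x*y g h)) (closed g∈H h∈H)

  Signed-* : ∀ {ε δ c d} → Signed ε c → Signed δ d → Signed (ε *ₙ δ) (c *ₙ d)
  Signed-* (inj₁ (refl , c∈H)) (inj₁ (refl , d∈H)) = inj₁ (refl , closed c∈H d∈H)
  Signed-* (inj₁ (refl , c∈H)) (inj₂ (refl , d∈-H)) = inj₂ (refl , ∈H*∈-H c∈H d∈-H)
  Signed-* {c = c} {d} (inj₂ (refl , c∈-H)) (inj₁ (refl , d∈H)) =
    inj₂ (refl , subst (_∈- H) (*ₙ-comm d c) (∈H*∈-H d∈H c∈-H))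
  Signed-* (inj₂ (refl , c∈-H)) (inj₂ (refl , d∈-H)) = inj₁ (refl , ∈-H*∈-H c∈-H d∈-H)

  Signed-^ : ∀ {ε c} → Signed ε c → ∀ k → Signed (ε ^ₙ k) (c ^ₙ k)
  Signed-^ s zero    = inj₁ (refl , has-one)
  Signed-^ s (suc k) = Signed-* s (Signed-^ s k)

  -- The inverse of `-ₙ h` is `-ₙ h⁻¹`, the two signs cancelling.
  inverse-∈- : ∀ {x y} → x ∈- H → x *ₙ y ≡ 1ₙ → y ∈- H
  inverse-∈- (h , h∈H , refl) xy≡1 with has-inverses h∈H
  ... | h⁻¹ , h⁻¹∈H , hh⁻¹≡1 =
    h⁻¹ , h⁻¹∈H , inverse-unique {x = -ₙ h} xy≡1 (trans (-x*-y≡x*y h h⁻¹) hh⁻¹≡1)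

  -- A negative power is a positive power of the inverses, and these have sign -1 just as `a` and
  -- `t` do.
  Signed-^ℤ : ∀ (a : Unit 3) (t : Unit n) → val a ≡ -ₙ 1ₙ → inv a ≡ -ₙ 1ₙ → val t ∈- H →
              ∀ l → Signed (a ^ℤ l) (t ^ℤ l)
  Signed-^ℤ a t a≡-1 a⁻¹≡-1 t∈-H (+ k)    = Signed-^ (inj₂ (a≡-1 , t∈-H)) k
  Signed-^ℤ a t a≡-1 a⁻¹≡-1 t∈-H -[1+ k ] =
    Signed-^ (inj₂ (a⁻¹≡-1 , inverse-∈- t∈-H (inverse t))) (suc k)

-- The unit group of ℤ_3 and the unit -1

-- Among all pairs of residues modulo 3, only (1, 1) and (2, 2) have product 1. The first is
-- excluded because the powers of 1 do not fill a group of order 2; in the second, 2 is -1.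
generator≡-1 : ∀ (a : Unit 3) (K : Subset 3) → IsUnitSubgroup K 2 → K IsGeneratedBy a →
               val a ≡ -ₙ 1ₙ × inv a ≡ -ₙ 1ₙ
generator≡-1 record { val = 0F ; inverse = () }
generator≡-1 record { val = 1F ; inv = 0F ; inverse = () }
generator≡-1 record { val = 1F ; inv = 2F ; inverse = () }
generator≡-1 record { val = 2F ; inv = 0F ; inverse = () }
generator≡-1 record { val = 2F ; inv = 1F ; inverse = () }
generator≡-1 record { val = 2F ; inv = 2F } K K-subgroup K-gen = refl , refl
generator≡-1 a@(record { val = 1F ; inv = 1F }) K K-subgroup K-gen =
  ⊥-elim (K-too-small K (IsUnitSubgroup.order K-subgroup) λ x∈K → ≡1 (Equivalence.to (K-gen _) x∈K))
  where
  ≡1 : ∀ {x} → ∃[ l ] x ≡ a ^ℤ l → x ≡ 1F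
  ≡1 (+ k      , eq) = trans eq (1-^ₙ k)
  ≡1 (-[1+ k ] , eq) = trans eq (1-^ₙ (suc k))

  -- The bits record the residues 0, 1, 2. A bit at 0 or 2 contradicts the inclusion in {1}, and
  -- without them there is at most one element.
  K-too-small : ∀ (K : Subset 3) → ∣ K ∣ ≡ 2 → ¬ (∀ {x} → x ∈ K → x ≡ 1F)
  K-too-small (inside  ∷ _ ∷ _ ∷ []) _ ⊆⁅1⁆ = contradiction (⊆⁅1⁆ here) λ()
  K-too-small (outside ∷ _ ∷ inside ∷ []) _ ⊆⁅1⁆ = contradiction (⊆⁅1⁆ (there (there here))) λ()
  K-too-small (outside ∷ inside  ∷ outside ∷ []) ()
  K-too-small (outside ∷ outside ∷ outside ∷ []) ()

-- This is H(3,2), the set {1, 2}.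
ℤ₃* : Subset 3
ℤ₃* = outside ∷ inside ∷ inside ∷ []

ℤ₃*-isUnitSubgroup : IsUnitSubgroup ℤ₃* 2
ℤ₃*-isUnitSubgroup = record
  { has-one      = there here
  ; closed       = closed
  ; has-inverses = has-inverses
  ; order        = refl
  }
  where
  closed : ∀ {x y} → x ∈ ℤ₃* → y ∈ ℤ₃* → x *ₙ y ∈ ℤ₃*
  closed {1F} {1F} _ _ = there here
  closed {1F} {2F} _ _ = there (there here)
  closed {2F} {1F} _ _ = there (there here)
  closed {2F} {2F} _ _ = there here

  has-inverses : ∀ {x} → x ∈ ℤ₃* → ∃[ y ] (y ∈ ℤ₃* × x *ₙ y ≡ 1ₙ)
  has-inverses {1F} x∈ = 1F , x∈ , refl
  has-inverses {2F} x∈ = 2F , x∈ , refl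

-- Taken modulo 3 it serves as `a`, and modulo `q` as `t`.
-1-unit : ∀ {n} .{{_ : NonZero n}} → Unit n
-1-unit = record { val = -ₙ 1ₙ ; inv = -ₙ 1ₙ ; inverse = -1*-1≡1 }

ℤ₃*-isGeneratedBy-[-1] : ℤ₃* IsGeneratedBy -1-unit
ℤ₃*-isGeneratedBy-[-1] x = mk⇔ (power x) λ { (l , refl) → ∈ℤ₃* l }
  where
  power : ∀ x → x ∈ ℤ₃* → ∃[ l ] x ≡ -1-unit ^ℤ l
  power 1F _ = + 0 , refl
  power 2F _ = + 1 , refl

  ^∈ℤ₃* : ∀ k → 2F ^ₙ k ∈ ℤ₃*
  ^∈ℤ₃* zero    = there here
  ^∈ℤ₃* (suc k) = IsUnitSubgroup.closed ℤ₃*-isUnitSubgroup (there (there here)) (^∈ℤ₃* k)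

  ∈ℤ₃* : ∀ l → -1-unit ^ℤ l ∈ ℤ₃*
  ∈ℤ₃* (+ k)    = ^∈ℤ₃* k
  ∈ℤ₃* -[1+ k ] = ^∈ℤ₃* (suc k)

-- The only positive exponent below 2 is 1, and -1 differs from 1 once `2 < n`.
-1-order : ∀ {n} .{{_ : NonZero n}} → 2 < n → IsOrderOf {n} 2 -1-unit
-1-order {n} 2<n = s≤s z≤n , -1^even≡1 ∣-refl , least
  where
  least : ∀ k → 0 < k → (-ₙ 1ₙ {n}) ^ₙ k ≡ 1ₙ → 2 ≤ k
  least (suc zero)    _ -1≡1 = contradiction
    (trans (sym -1≡1) (*ₙ-identityʳ _)) (1≢-1 2<n)
  least (suc (suc k)) _ _    = s≤s (s≤s z≤n)

-- Existence of parameters and equality of the two graphs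

module _ {q r : ℕ} .{{_ : NonZero q}} {H : Subset q} where

  -- Guarantees that the notation G(3q;r,2,u) denotes something. The choice `t = -1` works for every
  -- `r`, since 1 lies in `H`; its order 2 gives `u = lcm r 2`.
  canonicalParameters : Prime q → 3 < q → r ∣ q ∸ 1 → IsUnitSubgroup H r →
                        Parameters 3 q r 2 (lcm r 2) H
  canonicalParameters q-prime 3<q r∣q-1 H-subgroup = record
    { p-prime    = from-yes (prime? 3)
    ; q-prime    = q-prime
    ; p<q        = 3<q
    ; s-even     = ∣-refl
    ; s∣p-1      = ∣-refl
    ; r∣q-1      = r∣q-1
    ; H-subgroup = H-subgroup
    ; K          = ℤ₃*
    ; K-subgroup = ℤ₃*-isUnitSubgroup
    ; a          = -1-unit
    ; K-gen      = ℤ₃*-isGeneratedBy-[-1]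
    ; t          = -1-unit
    ; t-power    = 1ₙ , IsUnitSubgroup.has-one H-subgroup , *ₙ-identityʳ _
    ; o          = 2
    ; t-order    = -1-order (<-trans (n<1+n 2) 3<q)
    ; u-def      = refl
    }

  module _ {u : ℕ} (P : Parameters 3 q r 2 u H) where

    open Parameters P

    -- For `s = 2` the exponent `s / 2` is 1, and the first power unfolds to `val t *ₙ 1ₙ`.
    t∈-H : val t ∈- H
    t∈-H = subst (_∈- H) (*ₙ-identityʳ (val t)) t-power

    a≡-1 : val a ≡ -ₙ 1ₙ
    a≡-1 = proj₁ (generator≡-1 a K K-subgroup K-gen)

    a⁻¹≡-1 : inv a ≡ -ₙ 1ₙ
    a⁻¹≡-1 = proj₂ (generator≡-1 a K K-subgroup K-gen)

    -- Write `z` as `t` times `inv t *ₙ z`; the latter is a product of two elements of -H, so it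
    -- lies in `H`.
    ∈-H⇒∈tH : ∀ {z} → z ∈- H → z ∈ val t · H
    ∈-H⇒∈tH {z} z∈-H =
      inv t *ₙ z , ∈-H*∈-H H-subgroup (inverse-∈- H-subgroup t∈-H (inverse t)) z∈-H , (begin
        z                     ≡⟨ *ₙ-identityˡ z ⟨
        1ₙ *ₙ z               ≡⟨ cong (_*ₙ z) (inverse t) ⟨
        val t *ₙ inv t *ₙ z   ≡⟨ *ₙ-assoc (val t) (inv t) z ⟩
        val t *ₙ (inv t *ₙ z) ∎)
      where open ≡-Reasoning

    G₃⇒G : ∀ {v w} → G₃ q H v w → G P v w
    G₃⇒G (i , x , y , y-x∈H , inj₁ (refl , refl)) =
      -- Traversed forwards, the first coordinate grows by `a ^ 0 = 1`, and the coset `t ^ 0 · H` is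
      -- `H`.
      + 0 , y+z-y≡z i 1ₙ , y -ₙ x , y-x∈H , sym (*ₙ-identityˡ _)
    G₃⇒G (i , x , y , y-x∈H , inj₂ (refl , refl)) =
      -- Traversed backwards, the first coordinate changes by -1, which is `a`, and `x -ₙ y` lies in
      -- -H, hence in `t · H`.
      + 1 , i-[i+1]≡a , subst (λ c → (x -ₙ y) ∈ c · H) (sym (*ₙ-identityʳ (val t)))
        (∈-H⇒∈tH (y -ₙ x , y-x∈H , sym (-[x-y]≡y-x y x)))
      where
      open ≡-Reasoning
      i-[i+1]≡a : i -ₙ (i +ₙ 1ₙ) ≡ val a *ₙ 1ₙ
      i-[i+1]≡a = begin
        i -ₙ (i +ₙ 1ₙ)        ≡⟨ -[x-y]≡y-x (i +ₙ 1ₙ) i ⟨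
        -ₙ ((i +ₙ 1ₙ) -ₙ i)   ≡⟨ cong (λ z → -ₙ z) (y+z-y≡z i 1ₙ) ⟩
        -ₙ 1ₙ                 ≡⟨ a≡-1 ⟨
        val a                 ≡⟨ *ₙ-identityʳ (val a) ⟨
        val a *ₙ 1ₙ           ∎

    G⇒G₃ : ∀ {v w} → G P v w → G₃ q H v w
    G⇒G₃ {i , x} {j , y} (l , j-i≡a^l , h , h∈H , y-x≡t^l*h)
      with Signed-^ℤ H-subgroup a t a≡-1 a⁻¹≡-1 t∈-H l
    ... | inj₁ (a^l≡1 , t^l∈H) =
      -- Here `a ^ l = 1`, so the edge is oriented from `(i , x)` to `(j , y)`.
      i , x , y
      , subst (_∈ H) (sym y-x≡t^l*h) (IsUnitSubgroup.closed H-subgroup t^l∈H h∈H)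
      , inj₁ (refl , cong (_, y) (x-y≡z⇒x≡y+z j i (trans j-i≡a^l a^l≡1)))
    ... | inj₂ (a^l≡-1 , t^l∈-H)
      with ∈H*∈-H H-subgroup h∈H t^l∈-H
    ...   | g , g∈H , h*t^l≡-g =
      -- Here `a ^ l = -1`, so `(j , y)` is the tail of the edge. From `y -ₙ x = -ₙ g` the reversed
      -- difference `x -ₙ y` is `g`, an element of `H`.
      j , y , x
      , subst (_∈ H) (sym (y-x≡-z⇒x-y≡z x y (trans y-x≡t^l*h (trans (*ₙ-comm _ h) h*t^l≡-g)))) g∈H
      , inj₂ (cong (_, x) (x-y≡z⇒x≡y+z i j (y-x≡-z⇒x-y≡z i j (trans j-i≡a^l a^l≡-1))) , refl)

lemma4p12 : ∀ (q : ℕ) .{{_ : NonZero q}} → Prime q → 3 < q →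
    ∀ (r : ℕ) → 0 < r → r ∣ q ∸ 1 →
    ∀ (H : Subset q) → IsUnitSubgroup H r →
    (∃[ u ] Parameters 3 q r 2 u H) ×
    (∀ (u : ℕ) (P : Parameters 3 q r 2 u H) →
    (G₃ q H ⇔ G P) × (2 ∣ r → u ≡ r) × (¬ (2 ∣ r) → u ≡ 2 * r))
lemma4p12 q q-prime 3<q r 0<r r∣q-1 H H-subgroup =
  (lcm r 2 , canonicalParameters q-prime 3<q r∣q-1 H-subgroup) ,
  λ u P → let open Parameters P using (t; t-order; u-def) in
    (G₃⇒G P , G⇒G₃ P) ,
    (λ 2∣r → trans u-def (lcm[r,o]≡r H-subgroup q-prime 2∣r t (t∈-H P) t-order)) ,
    (λ r-odd → trans u-def
      (lcm[r,o]≡2r H-subgroup (<-trans (n<1+n 2) 3<q) r-odd t (t∈-H P) t-order))
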